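{- \begin{enumerate} \item[(i)] For $n^3\ll e\ll n^{40/13}$ we have $\mathrm{un}_4(n,e)\lesssim e^{4/3}/n^{10/3}$. \item[(ii)] For $n^{40/13}\ll e\le \binom{n}{4}$ we have $\mathrm{un}_4(n,e)\lesssim \frac{e^{1/4}\log n}{\log\left(\binom{n}{4}/e\right)}$. \end{enumerate}
   Context: A $4$-graph $\mathcal{H}$ is $(n,e)$-unavoidable if every $4$-graph ($4$-uniform hypergraph) on $n$ vertices with $e$ edges contains a copy of $\mathcal{H}$; $\mathrm{un}_4(n,e)$ is the maximum number of edges of an $(n,e)$-unavoidable $4$-graph. $f\lesssim g$ means $f\le Dg$ for an absolute constant $D$; $a\ll b$ means $a\le cb$ for a suitable absolute constant $c>0$ (so e.g. (i) is asserted for $C_0n^3\le e\le c_0n^{40/13}$ with suitable absolute constants $C_0,c_0$), for all sufficiently large $n$. -}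

module Defs where

open import Data.Nat using (ℕ; suc; _+_; _*_; _^_; _≤_)
open import Data.Nat.Combinatorics using (_C_)
open import Data.Fin using (Fin)
open import Data.Fin.Subset using (Subset; _∈_; ∣_∣)
open import Data.List using (List; length)
open import Data.List.Relation.Unary.All using (All)
open import Data.List.Relation.Unary.Any using (Any)
open import Data.List.Relation.Unary.Unique.Propositional using (Unique)
open import Data.Product using (Σ; ∃; _×_)
open import Function.Bundles using (_⇔_)
open import Function.Definitions using (Injective)
open import Relation.Binary.PropositionalEquality using (_≡_)

record Graph4 (n : ℕ) : Set where
  field
    edges   : List (Subset n)
    unique  : Unique edges
    uniform : All (λ S → ∣ S ∣ ≡ 4) edges
open Graph4 public

numEdges : ∀ {n} → Graph4 n → ℕ
numEdges G = length (edges G)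

IsImage : ∀ {m n} → (Fin m → Fin n) → Subset m → Subset n → Set
IsImage f S T = ∀ y → (y ∈ T ⇔ ∃ (λ x → x ∈ S × f x ≡ y))

Copy : ∀ {m n} → Graph4 m → Graph4 n → Set
Copy {m} {n} H G =
  Σ (Fin m → Fin n) λ f →
    Injective _≡_ _≡_ f × All (λ S → Any (IsImage f S) (edges G)) (edges H)

Unavoidable : ∀ {m} → ℕ → ℕ → Graph4 m → Set
Unavoidable n e H = (G : Graph4 n) → numEdges G ≡ e → Copy H G

-- Encoding (in ℕ) of the real inequality
--   u ≤ D · e^{1/4} · log n / log (binom(n,4)/e)      (for 1 ≤ e ≤ binom(n,4)),
-- i.e. (binom(n,4)/e)^s ≤ n with s = u / (D e^{1/4}), which (by monotonicity and
-- continuity of q ↦ (binom(n,4)/e)^q) holds iff for every rational a/b ≤ s one has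
-- (binom(n,4)/e)^{a/b} ≤ n, i.e. binom(n,4)^a ≤ n^b · e^a.
-- (When e = binom(n,4) the right-hand side is +∞ and this holds trivially.)
LogBound : ℕ → ℕ → ℕ → ℕ → Set
LogBound D n e u =
  ∀ a b → 1 ≤ b → a ^ 4 * D ^ 4 * e ≤ b ^ 4 * u ^ 4 →
    (n C 4) ^ a ≤ n ^ b * e ^ a

{-# OPTIONS --safe #-}
module Submission where

-- Let H have u edges and v non-isolated vertices, and put N = binom(n,4).  A random graph with e edges gives
-- N^u ≤ n^v e^u for every unavoidable H (made constructive by deleting one edge at a time from the complete
-- graph, always one lying in the most remaining copies of H), so it remains to bound v.  In (ii), H embeds into a clique on
-- O(e^{1/4}) vertices.  In (i), H embeds into the graph of all edges meeting a set of O(e/n^3) vertices, and into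
-- a disjoint union of cliques on O((e/n)^{1/3}) vertices.  The first copy gives a vertex cover of H and the second
-- confines the edges through a cover vertex to one clique, so v = O(e/n^3 · (e/n)^{1/3}); as N/e is at least
-- n^{12/13}, the random graph gives u ≤ 2v.

open import Defs
import Data.Bool.Properties as Bool
open import Data.Fin using (Fin; zero; suc; _↑ˡ_; _↑ʳ_; splitAt; fromℕ<; _≟_)
open import Data.Fin.Properties using (splitAt-↑ˡ; splitAt-↑ʳ; any?)
open import Data.Fin.Subset using (Subset; _∈_; ∣_∣; ⊥; inside; outside)
open import Data.Fin.Subset.Properties using (∣⊥∣≡0; ∉⊥; _∈?_; ⊆-antisym)
open import Data.List using (List; []; _∷_; _++_; [_]; length; map; filter; take; allFin; concatMap; cartesianProductWith)
open import Data.List.Properties using (length-map; length-++; length-++-sucʳ; length-take; length-filter; length-tabulate; take++drop≡id; map-cong-local)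
open import Data.List.Membership.Propositional using (find; lose) renaming (_∈_ to _∈ˡ_; _∉_ to _∉ˡ_)
open import Data.List.Membership.Propositional.Properties
open import Data.List.Relation.Binary.Permutation.Propositional using (_↭_; ↭-sym; ↭⇒↭ₛ)
open import Data.List.Relation.Binary.Permutation.Propositional.Properties using (shift; ↭-length; ∈-resp-↭)
open import Data.List.Relation.Binary.Permutation.Setoid.Properties using (Unique-resp-↭)
open import Data.List.Relation.Binary.Subset.Propositional using () renaming (_⊆_ to _⊆ˡ_)
open import Data.List.Relation.Unary.All as All using (All; []; _∷_)
import Data.List.Relation.Unary.All.Properties as All
open import Data.List.Relation.Unary.AllPairs using ([]; _∷_)
import Data.List.Relation.Unary.Any as Any
open import Data.List.Relation.Unary.Any using (here; there)
open import Data.List.Relation.Unary.Unique.Propositional using (Unique)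
import Data.List.Relation.Unary.Unique.Propositional.Properties as Unique
open import Data.Nat renaming (_≟_ to _≟ℕ_)
open import Data.Nat.Combinatorics
open import Data.Nat.DivMod
open import Data.Nat.ListAction using (sum)
open import Data.Nat.Properties hiding (_≟_)
open import Data.Nat.Tactic.RingSolver using (solve-∀)
open import Data.Product using (∃; ∃₂; _×_; _,_; proj₂)
open import Data.Sum using (inj₁; inj₂; [_,_]′)
open import Data.Vec as Vec using ([]; _∷_; here; there)
import Data.Vec.Properties as Vec
open import Data.Vec.Functional using (updateAt)
open import Data.Vec.Functional.Properties using (updateAt-updates; updateAt-minimal)
open import Function using (_∘_; id; const; Equivalence; mk⇔)
open import Function.Definitions using (Injective)
open import Relation.Binary.Definitions using (DecidableEquality)
open import Relation.Binary.PropositionalEquality hiding (J; [_])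
open import Relation.Nullary using (¬_; Dec; yes; no; does; contradiction; ¬?; _×-dec_)
open import Relation.Nullary.Decidable using (dec-true)
open import Relation.Unary using (Decidable)

private variable
  A B : Set
  m n k : ℕ

-- Counting in lists

unique-⊆⇒length≤ : ∀ {xs ys : List A} → Unique xs → xs ⊆ˡ ys → length xs ≤ length ys
unique-⊆⇒length≤ [] _ = z≤n
unique-⊆⇒length≤ {xs = x ∷ xs} (x∉xs ∷ uxs) xs⊆ys with ∈-∃++ (xs⊆ys (here refl))
... | ys₁ , ys₂ , refl =
  ≤-trans (s≤s (unique-⊆⇒length≤ uxs xs⊆rest)) (≤-reflexive (sym (length-++-sucʳ ys₁ x ys₂)))
  where
  xs⊆rest : xs ⊆ˡ ys₁ ++ ys₂
  xs⊆rest z∈xs with ∈-resp-↭ (shift x ys₁ ys₂) (xs⊆ys (there z∈xs))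
  ... | here refl = contradiction refl (All.lookup x∉xs z∈xs)
  ... | there z∈  = z∈

length-filter-¬ : ∀ {P : A → Set} (P? : Decidable P) xs →
  length (filter P? xs) + length (filter (¬? ∘ P?) xs) ≡ length xs
length-filter-¬ P? [] = refl
length-filter-¬ P? (x ∷ xs) with P? x
... | yes _ = cong suc (length-filter-¬ P? xs)
... | no  _ = trans (+-suc _ _) (cong suc (length-filter-¬ P? xs))

max≥average : ∀ (f : A → ℕ) xs → 0 < length xs →
  ∃ λ x → x ∈ˡ xs × sum (map f xs) ≤ f x * length xs
max≥average f (x ∷ []) _ = x , here refl , ≤-reflexive (trans (+-identityʳ (f x)) (sym (*-identityʳ (f x))))
max≥average f (x ∷ xs@(_ ∷ _)) _ with max≥average f xs z<s
... | z , z∈xs , avg with ≤-total (f x) (f z)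
...   | inj₁ fx≤fz = z , there z∈xs ,
        ≤-trans (+-mono-≤ fx≤fz avg) (≤-reflexive (sym (*-suc (f z) _)))
...   | inj₂ fz≤fx = x , here refl ,
        ≤-trans (+-monoʳ-≤ (f x) (≤-trans avg (*-monoˡ-≤ _ fz≤fx))) (≤-reflexive (sym (*-suc (f x) _)))

-- Greedy deletion

-- Bernoulli's inequality (1 - 1/(j+1))^u ≥ 1 - u/(j+1), cleared of denominators and subtraction.
bernoulli : ∀ j u → suc j * suc j ^ u ≤ suc j * j ^ u + u * suc j ^ u
bernoulli j zero    = ≤-reflexive (sym (+-identityʳ _))
bernoulli j (suc u) = begin
  suc j * (suc j * suc j ^ u)                         ≤⟨ *-monoʳ-≤ (suc j) (bernoulli j u) ⟩
  suc j * (suc j * j ^ u + u * suc j ^ u)             ≡⟨ arith j u (j ^ u) (suc j ^ u) ⟩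
  suc j * (j * j ^ u) + u * (suc j * suc j ^ u) + suc j * j ^ u
    ≤⟨ +-monoʳ-≤ (suc j * (j * j ^ u) + u * (suc j * suc j ^ u)) (*-monoʳ-≤ (suc j) (^-monoˡ-≤ u (n≤1+n j))) ⟩
  suc j * (j * j ^ u) + u * (suc j * suc j ^ u) + suc j * suc j ^ u
    ≡⟨ arith′ (suc j * (j * j ^ u)) u (suc j * suc j ^ u) ⟩
  suc j * (j * j ^ u) + suc u * (suc j * suc j ^ u)   ∎
  where
  open ≤-Reasoning
  arith : ∀ j u p q → suc j * (suc j * p + u * q) ≡ suc j * (j * p) + u * (suc j * q) + suc j * p
  arith = solve-∀
  arith′ : ∀ a u q → a + u * q + q ≡ a + suc u * q
  arith′ = solve-∀

UniformIn : ℕ → List A → List A → Set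
UniformIn u G E = Unique E × length E ≡ u × E ⊆ˡ G

module _ (_≟ᴬ_ : DecidableEquality A) where

  open import Data.List.Membership.DecPropositional _≟ᴬ_ using () renaming (_∈?_ to _∈ˡ?_)

  degree : List (List A) → A → ℕ
  degree F x = length (filter (x ∈ˡ?_) F)

  -- Double counting of incidences: each set of `F` has `u` distinct points, all of them in `G`, and
  -- so adds at least `u` to the sum of the degrees.
  degree-sum : ∀ {u} {G : List A} {F} → All (UniformIn u G) F → length F * u ≤ sum (map (degree F) G)
  degree-sum [] = z≤n
  degree-sum {u} {G} {E ∷ F} ((uE , refl , E⊆G) ∷ unif) = begin
    u + length F * u ≤⟨ +-mono-≤ (unique-⊆⇒length≤ uE λ x∈E → ∈-filter⁺ (_∈ˡ? E) (E⊆G x∈E) x∈E) (degree-sum unif) ⟩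
    length (filter (_∈ˡ? E) G) + sum (map (degree F) G) ≡⟨ split G ⟩
    sum (map (degree (E ∷ F)) G) ∎
    where
    open ≤-Reasoning
    swap : ∀ a b c → a + (b + c) ≡ b + (a + c)
    swap = solve-∀
    split : ∀ G → length (filter (_∈ˡ? E) G) + sum (map (degree F) G) ≡ sum (map (degree (E ∷ F)) G)
    split [] = refl
    split (x ∷ G) with x ∈ˡ? E
    ... | yes _ = cong suc (trans (swap (length (filter (_∈ˡ? E) G)) (degree F x) _) (cong (degree F x +_) (split G)))
    ... | no _  = trans (swap (length (filter (_∈ˡ? E) G)) (degree F x) _) (cong (degree F x +_) (split G))

  -- By double counting, a point x of maximum degree lies in at least the fraction u/|G| of the sets in F.
  deletion : ∀ {u} {G : List A} {F} → 0 < length G → All (UniformIn u G) F →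
    ∃₂ λ x G′ → G ↭ x ∷ G′ ×
      length (filter (¬? ∘ (x ∈ˡ?_)) F) * suc (length G′) ^ u ≤ length F * length G′ ^ u
  deletion {u} {G} {F} 0<G unif with max≥average (degree F) G 0<G
  ... | x , x∈G , avg with ∈-∃++ x∈G
  ...   | G₁ , G₂ , refl = x , G₁ ++ G₂ , shift x G₁ G₂ , decay
    where
    j = length (G₁ ++ G₂)
    J = suc j
    f = length F
    f′ = length (filter (¬? ∘ (x ∈ˡ?_)) F)
    open ≤-Reasoning
    -- This is f′ ≤ f (1 - u/J) without subtraction: the average degree is at least f u / J, and `x`
    -- reaches it.
    fewer : J * f′ + f * u ≤ J * f
    fewer = begin
      J * f′ + f * u
        ≤⟨ +-monoʳ-≤ (J * f′) (≤-trans (degree-sum unif)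
             (subst (λ l → sum (map (degree F) G) ≤ degree F x * l) (↭-length (shift x G₁ G₂)) avg)) ⟩
      J * f′ + degree F x * J   ≡⟨ arith J f′ (degree F x) ⟩
      J * (degree F x + f′)     ≡⟨ cong (J *_) (length-filter-¬ (x ∈ˡ?_) F) ⟩
      J * f                     ∎
      where
      arith : ∀ a b c → a * b + c * a ≡ a * (c + b)
      arith = solve-∀
    -- Bernoulli turns 1 - u/J into (j/J)^u. The term `u * J ^ u * f` is carried on both sides and
    -- cancelled at the end.
    decay : f′ * J ^ u ≤ f * j ^ u
    decay = *-cancelˡ-≤ J (+-cancelʳ-≤ (u * J ^ u * f) _ _ (begin
      J * (f′ * J ^ u) + u * J ^ u * f  ≡⟨ arith₁ J f′ (J ^ u) u f ⟩
      J ^ u * (J * f′ + f * u)          ≤⟨ *-monoʳ-≤ (J ^ u) fewer ⟩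
      J ^ u * (J * f)                   ≡⟨ arith₂ (J ^ u) J f ⟩
      J * J ^ u * f                     ≤⟨ *-monoˡ-≤ f (bernoulli j u) ⟩
      (J * j ^ u + u * J ^ u) * f       ≡⟨ arith₃ J (j ^ u) (u * J ^ u) f ⟩
      J * (f * j ^ u) + u * J ^ u * f   ∎))
      where
      arith₁ : ∀ J f′ p u f → J * (f′ * p) + u * p * f ≡ p * (J * f′ + f * u)
      arith₁ = solve-∀
      arith₂ : ∀ p J f → p * (J * f) ≡ J * p * f
      arith₂ = solve-∀
      arith₃ : ∀ J q r f → (J * q + r) * f ≡ J * (f * q) + r * f
      arith₃ = solve-∀

  -- Here `d` counts the points still to be deleted. The ratio |F| (e/|G|)^u bounds the expected
  -- number of sets of `F` inside a random `e`-subset of `G`; by `deletion` it never grows, so it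
  -- stays below 1.
  avoid : ∀ {u e} d {G : List A} F → 0 < e → Unique G → length G ≡ d + e → All (UniformIn u G) F →
    length F * e ^ u < length G ^ u →
    ∃ λ G′ → Unique G′ × G′ ⊆ˡ G × length G′ ≡ e × All (λ E → ¬ E ⊆ˡ G′) F
  avoid zero {G} [] 0<e uG lenG unif small = G , uG , id , lenG , []
  -- Once |G| = e, the ratio is |F| itself, so `F` must be empty.
  avoid zero (_ ∷ _) 0<e uG refl unif small = contradiction small (≤⇒≯ (m≤m+n _ _))
  avoid {u} {e} (suc d) {G} F 0<e uG lenG unif small
    with deletion (subst (0 <_) (sym lenG) z<s) unif
  ... | x , G′ , perm , decay with Unique-resp-↭ (setoid A) (↭⇒↭ₛ perm) uG
  ...   | x∉G′ ∷ uG′ =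
    let H , uH , H⊆G′ , lenH , none =
          avoid d (filter (¬? ∘ (x ∈ˡ?_)) F) 0<e uG′ lenG′ (All.tabulate (shrink ∘ ∈-filter⁻ (¬? ∘ (x ∈ˡ?_)))) small′
    in H , uH , ∈-resp-↭ (↭-sym perm) ∘ there ∘ H⊆G′ , lenH , All.tabulate (extend H⊆G′ none)
    where
    lenG′ : length G′ ≡ d + e
    lenG′ = suc-injective (trans (sym (↭-length perm)) lenG)
    shrink : ∀ {E} → E ∈ˡ F × x ∉ˡ E → UniformIn u G′ E
    shrink {E} (E∈F , x∉E) = let uE , lenE , E⊆G = All.lookup unif E∈F in uE , lenE , sub E⊆G
      where
      sub : E ⊆ˡ G → E ⊆ˡ G′
      sub E⊆G y∈E with ∈-resp-↭ perm (E⊆G y∈E)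
      ... | here refl = contradiction y∈E x∉E
      ... | there y∈  = y∈
    extend : ∀ {H} → H ⊆ˡ G′ → All (λ E → ¬ E ⊆ˡ H) (filter (¬? ∘ (x ∈ˡ?_)) F) →
      ∀ {E} → E ∈ˡ F → ¬ E ⊆ˡ H
    -- A set through the deleted point cannot lie in `H`; every other set was passed on to the
    -- recursive call.
    extend H⊆G′ none {E} E∈F E⊆H with x ∈ˡ? E
    ... | yes x∈E = contradiction refl (All.lookup x∉G′ (H⊆G′ (E⊆H x∈E)))
    ... | no  x∉E = All.lookup none (∈-filter⁺ (¬? ∘ (x ∈ˡ?_)) E∈F x∉E) E⊆H
    j = length G′
    J = suc j
    f = length F
    f′ = length (filter (¬? ∘ (x ∈ˡ?_)) F)
    -- The strict step in `small′` multiplies by `j ^ u`, which is positive because `j` is at least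
    -- `e`.
    instance
      j^u≢0 : NonZero (j ^ u)
      j^u≢0 = m^n≢0 j u {{>-nonZero (subst (0 <_) (sym lenG′) (≤-trans 0<e (m≤n+m e d)))}}
    small′ : f′ * e ^ u < j ^ u
    small′ = *-cancelʳ-< (J ^ u) _ _ (begin-strict
      f′ * e ^ u * J ^ u   ≡⟨ arith f′ (e ^ u) (J ^ u) ⟩
      f′ * J ^ u * e ^ u   ≤⟨ *-monoˡ-≤ (e ^ u) decay ⟩
      f * j ^ u * e ^ u    ≡⟨ arith f (j ^ u) (e ^ u) ⟩
      f * e ^ u * j ^ u    <⟨ *-monoˡ-< (j ^ u) (subst (λ l → f * e ^ u < l ^ u) (↭-length perm) small) ⟩
      J ^ u * j ^ u        ≡⟨ *-comm (J ^ u) (j ^ u) ⟩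
      j ^ u * J ^ u        ∎)
      where
      open ≤-Reasoning
      arith : ∀ a b c → a * b * c ≡ a * c * b
      arith = solve-∀

-- Families of k-subsets

nCk≤[n+1]Ck : ∀ n k → n C k ≤ suc n C k
nCk≤[n+1]Ck n zero    = ≤-refl
nCk≤[n+1]Ck n (suc k) = ≤-trans (m≤n+m (n C suc k) (n C k)) (≤-reflexive (nCk+nC[k+1]≡[n+1]C[k+1] n k))

[n∸a]Ck≤nCk : ∀ n a k → (n ∸ a) C k ≤ n C k
[n∸a]Ck≤nCk n       zero    k = ≤-refl
[n∸a]Ck≤nCk zero    (suc a) k = ≤-refl
[n∸a]Ck≤nCk (suc n) (suc a) k = ≤-trans ([n∸a]Ck≤nCk n a k) (nCk≤[n+1]Ck n k)

∣p∣≡0⇒p≡⊥ : ∀ (p : Subset n) → ∣ p ∣ ≡ 0 → p ≡ ⊥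
∣p∣≡0⇒p≡⊥ []            _  = refl
∣p∣≡0⇒p≡⊥ (outside ∷ p) eq = cong (outside ∷_) (∣p∣≡0⇒p≡⊥ p eq)

∣p++⊥∣≡∣p∣ : ∀ (p : Subset n) {r} → ∣ p Vec.++ ⊥ {r} ∣ ≡ ∣ p ∣
∣p++⊥∣≡∣p∣ []            {r} = ∣⊥∣≡0 r
∣p++⊥∣≡∣p∣ (inside  ∷ p)     = cong suc (∣p++⊥∣≡∣p∣ p)
∣p++⊥∣≡∣p∣ (outside ∷ p)     = ∣p++⊥∣≡∣p∣ p

∣⊥++p∣≡∣p∣ : ∀ s (p : Subset n) → ∣ ⊥ {s} Vec.++ p ∣ ≡ ∣ p ∣
∣⊥++p∣≡∣p∣ zero    p = refl
∣⊥++p∣≡∣p∣ (suc s) p = ∣⊥++p∣≡∣p∣ s p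

∈-p++⊥ : ∀ (p : Subset n) {r x} → x ∈ p Vec.++ ⊥ {r} → ∃ λ y → y ∈ p × x ≡ y ↑ˡ r
∈-p++⊥ []      x∈         = contradiction x∈ ∉⊥
∈-p++⊥ (_ ∷ p) here       = zero , here , refl
∈-p++⊥ (_ ∷ p) (there x∈) with ∈-p++⊥ p x∈
... | y , y∈p , refl = suc y , there y∈p , refl

∈-⊥++p : ∀ s {p : Subset n} {x} → x ∈ ⊥ {s} Vec.++ p → ∃ λ y → y ∈ p × x ≡ s ↑ʳ y
∈-⊥++p zero    x∈ = _ , x∈ , refl
∈-⊥++p (suc s) (there x∈) with ∈-⊥++p s x∈
... | y , y∈p , refl = y , y∈p , refl

-- For `k` = 4 these are the fields of `Graph4`; a general `k` permits recursion by Pascal's rule.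
record Family (n k : ℕ) : Set where
  field
    members  : List (Subset n)
    distinct : Unique members
    sized    : All (λ S → ∣ S ∣ ≡ k) members
open Family

∅ : Family n k
∅ = record { members = [] ; distinct = [] ; sized = [] }

-- Pascal's rule for families: `F` supplies the sets that contain the new vertex `zero`, `G` those
-- that avoid it.
join : Family n k → Family n (suc k) → Family (suc n) (suc k)
join F G = record
  { members  = map (inside ∷_) (members F) ++ map (outside ∷_) (members G)
  ; distinct = Unique.++⁺ (Unique.map⁺ Vec.∷-injectiveʳ (distinct F)) (Unique.map⁺ Vec.∷-injectiveʳ (distinct G)) disjoint
  ; sized    = All.++⁺ (All.map⁺ (All.map (cong suc) (sized F))) (All.map⁺ (sized G))
  }
  where
  disjoint : ∀ {S} → ¬ (S ∈ˡ map (inside ∷_) (members F) × S ∈ˡ map (outside ∷_) (members G))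
  disjoint (S∈F , S∈G) with ∈-map⁻ (inside ∷_) S∈F | ∈-map⁻ (outside ∷_) S∈G
  ... | _ , _ , refl | _ , _ , ()

length-join : ∀ (F : Family n k) G → length (members (join F G)) ≡ length (members F) + length (members G)
length-join F G = trans (length-++ (map (inside ∷_) (members F)))
  (cong₂ _+_ (length-map (inside ∷_) (members F)) (length-map (outside ∷_) (members G)))

complete : ∀ n k → Family n k
complete n       zero    = record { members = [ ⊥ ] ; distinct = [] ∷ [] ; sized = ∣⊥∣≡0 n ∷ [] }
complete zero    (suc k) = ∅
complete (suc n) (suc k) = join (complete n k) (complete n (suc k))

length-complete : ∀ n k → length (members (complete n k)) ≡ n C k
length-complete n       zero    = refl
length-complete zero    (suc k) = refl
length-complete (suc n) (suc k) = trans (length-join (complete n k) (complete n (suc k)))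
  (trans (cong₂ _+_ (length-complete n k) (length-complete n (suc k))) (nCk+nC[k+1]≡[n+1]C[k+1] n k))

∈-complete : ∀ (S : Subset n) → ∣ S ∣ ≡ k → S ∈ˡ members (complete n k)
∈-complete {k = zero}  S             eq   = here (∣p∣≡0⇒p≡⊥ S eq)
∈-complete {k = suc k} (inside  ∷ S) refl = ∈-++⁺ˡ (∈-map⁺ (inside ∷_) (∈-complete S refl))
∈-complete {k = suc k} (outside ∷ S) eq   = ∈-++⁺ʳ _ (∈-map⁺ (outside ∷_) (∈-complete S eq))

juxtapose : ∀ {s} → Family s (suc k) → Family n (suc k) → Family (s + n) (suc k)
juxtapose {k = k} {n} {s} F G = record
  { members  = map (Vec._++ ⊥) (members F) ++ map (⊥ {s} Vec.++_) (members G)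
  ; distinct = Unique.++⁺ (Unique.map⁺ (Vec.++-injectiveˡ _ _) (distinct F))
                 (Unique.map⁺ (Vec.++-injectiveʳ (⊥ {s}) ⊥) (distinct G)) disjoint
  ; sized    = All.++⁺ (All.map⁺ (All.map (λ {S} → trans (∣p++⊥∣≡∣p∣ S)) (sized F)))
                 (All.map⁺ (All.map (λ {S} → trans (∣⊥++p∣≡∣p∣ s S)) (sized G)))
  }
  where
  disjoint : ∀ {S} → ¬ (S ∈ˡ map (Vec._++ ⊥) (members F) × S ∈ˡ map (⊥ {s} Vec.++_) (members G))
  disjoint (S∈F , S∈G) with ∈-map⁻ (Vec._++ ⊥) S∈F | ∈-map⁻ (⊥ {s} Vec.++_) S∈G
  -- A set coming from both sides would have an empty left part, but members have `suc k` > 0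
  -- elements.
  ... | S₁ , S₁∈F , refl | S₂ , _ , eq =
    1+n≢0 (trans (sym (All.lookup (sized F) S₁∈F)) (trans (cong ∣_∣ (Vec.++-injectiveˡ S₁ ⊥ eq)) (∣⊥∣≡0 s)))

length-juxtapose : ∀ {s} (F : Family s (suc k)) (G : Family n (suc k)) →
  length (members (juxtapose F G)) ≡ length (members F) + length (members G)
length-juxtapose {s = s} F G = trans (length-++ (map (Vec._++ ⊥) (members F)))
  (cong₂ _+_ (length-map (Vec._++ ⊥) (members F)) (length-map (⊥ {s} Vec.++_) (members G)))

-- The family of all sets that meet the first `a` vertices. Sorted by least element they fall into
-- `a` classes, each with at least binom(n - a, k) members.
star : ∀ a k n → a ≤ n → ∃₂ λ (F : Family n (suc k)) (A : List (Fin n)) →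
  a * ((n ∸ a) C k) ≤ length (members F) × length A ≡ a ×
  (∀ {S} → S ∈ˡ members F → ∃ λ x → x ∈ S × x ∈ˡ A)
star zero    k n       _         = ∅ , [] , z≤n , refl , λ ()
star (suc a) k (suc n) (s≤s a≤n) with star a k n a≤n
... | F , A , many , lenA , meets = join (complete n k) F , zero ∷ map suc A ,
    ≤-trans (+-mono-≤ ([n∸a]Ck≤nCk n a k) many)
      (≤-reflexive (sym (trans (length-join (complete n k) F) (cong (_+ _) (length-complete n k))))) ,
    cong suc (trans (length-map suc A) lenA) , meets′
  where
  meets′ : ∀ {S} → S ∈ˡ members (join (complete n k) F) → ∃ λ x → x ∈ S × x ∈ˡ zero ∷ map suc A
  meets′ S∈ with ∈-++⁻ (map (inside ∷_) (members (complete n k))) S∈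
  ... | inj₁ S∈ᵢ with ∈-map⁻ (inside ∷_) S∈ᵢ
  ...   | _ , _ , refl = zero , here , here refl
  meets′ S∈ | inj₂ S∈ₒ with ∈-map⁻ (outside ∷_) S∈ₒ
  ...   | _ , S′∈ , refl = let x , x∈S , x∈A = meets S′∈ in suc x , there x∈S , there (∈-map⁺ suc x∈A)

clique : ∀ t k n → t ≤ n → ∃₂ λ (F : Family n (suc k)) (K : List (Fin n)) →
  length (members F) ≡ t C suc k × length K ≡ t × (∀ {S x} → S ∈ˡ members F → x ∈ S → x ∈ˡ K)
clique t k n t≤n with m≤n⇒∃[o]m+o≡n t≤n
... | r , refl = juxtapose (complete t (suc k)) ∅ , map (_↑ˡ r) (allFin t) ,
    trans (length-juxtapose (complete t (suc k)) ∅) (trans (+-identityʳ _) (length-complete t (suc k))) ,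
    trans (length-map (_↑ˡ r) (allFin t)) (length-tabulate {n = t} id) , inK
  where
  inK : ∀ {S x} → S ∈ˡ members (juxtapose (complete t (suc k)) (∅ {r})) → x ∈ S → x ∈ˡ map (_↑ˡ r) (allFin t)
  inK S∈ x∈S with ∈-++⁻ (map (Vec._++ ⊥) (members (complete t (suc k)))) S∈
  ... | inj₁ S∈ˡ with ∈-map⁻ (Vec._++ ⊥) S∈ˡ
  ...   | S′ , _ , refl with ∈-p++⊥ S′ x∈S
  ...     | y , _ , refl = ∈-map⁺ (_↑ˡ r) (∈-allFin y)

-- `B x` is the vertex set of the clique that holds `x`; it is empty for the leftover vertices,
-- which lie in no member.
blocks : ∀ s k q n → q * s ≤ n → ∃₂ λ (F : Family n (suc k)) (B : Fin n → List (Fin n)) →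
  length (members F) ≡ q * (s C suc k) × (∀ x → length (B x) ≤ s) ×
  (∀ {S x y} → S ∈ˡ members F → x ∈ S → y ∈ S → y ∈ˡ B x)
blocks s k zero    n _    = ∅ , const [] , refl , const z≤n , λ ()
blocks s k (suc q) n qs≤n with m≤n⇒∃[o]m+o≡n (≤-trans (m≤m+n s (q * s)) qs≤n)
... | r , refl with blocks s k q r (+-cancelˡ-≤ s _ _ qs≤n)
...   | F , B , lenF , lenB , inB = juxtapose (complete s (suc k)) F , [ first , rest ]′ ∘ splitAt s ,
    trans (length-juxtapose (complete s (suc k)) F) (cong₂ _+_ (length-complete s (suc k)) lenF) , lenB′ , inB′
  where
  first : Fin s → List (Fin (s + r))
  first _ = map (_↑ˡ r) (allFin s)
  rest : Fin r → List (Fin (s + r))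
  rest x = map (s ↑ʳ_) (B x)
  lenB′ : ∀ x → length ([ first , rest ]′ (splitAt s x)) ≤ s
  lenB′ x with splitAt s x
  ... | inj₁ y = ≤-reflexive (trans (length-map (_↑ˡ r) (allFin s)) (length-tabulate {n = s} id))
  ... | inj₂ y = ≤-trans (≤-reflexive (length-map (s ↑ʳ_) (B y))) (lenB y)
  inB′ : ∀ {S x y} → S ∈ˡ members (juxtapose (complete s (suc k)) F) → x ∈ S → y ∈ S →
    y ∈ˡ [ first , rest ]′ (splitAt s x)
  inB′ S∈ x∈S y∈S with ∈-++⁻ (map (Vec._++ ⊥) (members (complete s (suc k)))) S∈
  ... | inj₁ S∈ˡ with ∈-map⁻ (Vec._++ ⊥) S∈ˡ
  ...   | S′ , _ , refl with ∈-p++⊥ S′ x∈S | ∈-p++⊥ S′ y∈S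
  ...     | x′ , _ , refl | y′ , _ , refl rewrite splitAt-↑ˡ s x′ r = ∈-map⁺ (_↑ˡ r) (∈-allFin y′)
  inB′ S∈ x∈S y∈S | inj₂ S∈ʳ with ∈-map⁻ (⊥ {s} Vec.++_) S∈ʳ
  ...   | S′ , S′∈F , refl with ∈-⊥++p s x∈S | ∈-⊥++p s y∈S
  ...     | x′ , x′∈ , refl | y′ , y′∈ , refl rewrite splitAt-↑ʳ s r x′ = ∈-map⁺ (s ↑ʳ_) (inB S′∈F x′∈ y′∈)

toGraph : ∀ (F : Family n 4) {e} → e ≤ length (members F) →
  ∃ λ (G : Graph4 n) → numEdges G ≡ e × edges G ⊆ˡ members F
toGraph F {e} e≤F = record
    { edges   = take e (members F)
    ; unique  = Unique.take⁺ e (distinct F)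
    ; uniform = All.take⁺ e (sized F)
    } , trans (length-take e (members F)) (m≤n⇒m⊓n≡m e≤F) ,
  subst (_ ∈ˡ_) (take++drop≡id e (members F)) ∘ ∈-++⁺ˡ

-- Unavoidability speaks of exactly `e` edges, so `F` is cut down to `e` members; the copy found
-- there also lies in `F`.
copy-in : ∀ {e} {H : Graph4 m} → Unavoidable n e H → (F : Family n 4) → e ≤ length (members F) →
  ∃ λ (f : Fin m → Fin n) → Injective _≡_ _≡_ f ×
    (∀ {S} → S ∈ˡ edges H → ∃ λ T → T ∈ˡ members F × IsImage f S T)
copy-in un F e≤F with toGraph F e≤F
... | G , numG , G⊆F with un G numG
...   | f , inj , copies = f , inj , λ S∈H → let T , T∈G , im = find (All.lookup copies S∈H) in T , G⊆F T∈G , im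

-- Copies of H

-- The non-isolated vertices, whose number is the v of the overview. Isolated vertices are
-- constrained by no edge, so `m` itself admits no such bound.
support : Graph4 m → List (Fin m)
support {m} H = filter (λ x → Any.any? (x ∈?_) (edges H)) (allFin m)

support-unique : ∀ (H : Graph4 m) → Unique (support H)
support-unique {m} H = Unique.filter⁺ (λ x → Any.any? (x ∈?_) (edges H)) (Unique.allFin⁺ m)

∈-support⁺ : ∀ (H : Graph4 m) {S x} → S ∈ˡ edges H → x ∈ S → x ∈ˡ support H
∈-support⁺ H {x = x} S∈H x∈S = ∈-filter⁺ (λ x → Any.any? (x ∈?_) (edges H)) (∈-allFin x) (lose S∈H x∈S)

∈-support⁻ : ∀ (H : Graph4 m) {x} → x ∈ˡ support H → ∃ λ S → S ∈ˡ edges H × x ∈ S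
∈-support⁻ {m} H x∈ = find (proj₂ (∈-filter⁻ (λ x → Any.any? (x ∈?_) (edges H)) {xs = allFin m} x∈))

injective⇒length≤ : ∀ {f : Fin m → Fin n} {xs ys} → Injective _≡_ _≡_ f → Unique xs →
  (∀ {x} → x ∈ˡ xs → f x ∈ˡ ys) → length xs ≤ length ys
injective⇒length≤ {f = f} {xs} {ys} inj uxs fxs⊆ys =
  subst (_≤ length ys) (length-map f xs) (unique-⊆⇒length≤ (Unique.map⁺ inj uxs) map⊆)
  where
  map⊆ : map f xs ⊆ˡ ys
  map⊆ y∈ with ∈-map⁻ f y∈
  ... | x , x∈xs , refl = fxs⊆ys x∈xs

length-concatMap≤ : ∀ (f : A → List B) {s} → (∀ x → length (f x) ≤ s) →
  ∀ xs → length (concatMap f xs) ≤ length xs * s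
length-concatMap≤ f f≤s []       = z≤n
length-concatMap≤ f f≤s (x ∷ xs) = ≤-trans (≤-reflexive (length-++ (f x)))
  (+-mono-≤ (f≤s x) (length-concatMap≤ f f≤s xs))

∈-image⁺ : ∀ {f : Fin m → Fin n} {S T x} → IsImage f S T → x ∈ S → f x ∈ T
∈-image⁺ im x∈S = Equivalence.from (im _) (_ , x∈S , refl)

-- Every non-isolated vertex lies in an edge, whose image lies in the clique, and the copy is
-- injective.
clique-support : ∀ {e} {H : Graph4 m} t → Unavoidable n e H → t ≤ n → e ≤ t C 4 → length (support H) ≤ t
clique-support {n = n} {e} {H} t un t≤n e≤ with clique t 3 n t≤n
... | F , K , lenF , refl , inK with copy-in {H = H} un F (subst (e ≤_) (sym lenF) e≤)
...   | f , inj , copy = injective⇒length≤ inj (support-unique H) λ x∈ →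
        let S , S∈H , x∈S = ∈-support⁻ H x∈
            T , T∈F , im  = copy S∈H
        in inK T∈F (∈-image⁺ im x∈S)

-- The copy of H in the star family gives a vertex cover of size a, and the copy in the blocks
-- confines every edge through a cover vertex to the block of that vertex.
star-blocks-support : ∀ {e} {H : Graph4 m} a q s → Unavoidable n e H →
  a ≤ n → e ≤ a * ((n ∸ a) C 3) → q * s ≤ n → e ≤ q * (s C 4) → length (support H) ≤ a * s
star-blocks-support {m} {n} {e} {H} a q s un a≤n e≤star qs≤n e≤blocks
  with star a 3 n a≤n | blocks s 3 q n qs≤n
... | F , A , lenF , refl , meets | F′ , B , lenF′ , lenB , inB
  with copy-in {H = H} un F (≤-trans e≤star lenF) | copy-in {H = H} un F′ (subst (e ≤_) (sym lenF′) e≤blocks)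
... | g , g-inj , g-copy | f , f-inj , f-copy = begin
  length (support H)                  ≤⟨ injective⇒length≤ f-inj (support-unique H) near-centre ⟩
  length (concatMap (B ∘ f) centres)  ≤⟨ length-concatMap≤ (B ∘ f) (lenB ∘ f) centres ⟩
  length centres * s                  ≤⟨ *-monoˡ-≤ s (injective⇒length≤ g-inj centres-unique (proj₂ ∘ ∈-filter⁻ centre? {xs = allFin m})) ⟩
  length A * s                        ∎
  where
  open ≤-Reasoning
  open import Data.List.Membership.DecPropositional _≟_ using () renaming (_∈?_ to _∈ˡ?_)
  centre? : ∀ x → Dec (g x ∈ˡ A)
  centre? x = g x ∈ˡ? A
  -- The cover of the star is pulled back along `g`; injectivity of `g` bounds its size by that of
  -- `A`.
  centres : List (Fin m)
  centres = filter centre? (allFin m)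
  centres-unique : Unique centres
  centres-unique = Unique.filter⁺ centre? (Unique.allFin⁺ m)
  near-centre : ∀ {x} → x ∈ˡ support H → f x ∈ˡ concatMap (B ∘ f) centres
  -- An edge `S` through `x` has a centre `c`, found through `g`; under `f` the image of `S` lies in
  -- one block, which thus holds both `f c` and `f x`.
  near-centre x∈ with ∈-support⁻ H x∈
  ... | S , S∈H , x∈S with g-copy S∈H | f-copy S∈H
  ...   | T , T∈F , im | T′ , T′∈F′ , im′ with meets T∈F
  ...     | y , y∈T , y∈A with Equivalence.to (im y) y∈T
  ...       | c , c∈S , refl = ∈-concatMap⁺ (B ∘ f) (lose (∈-filter⁺ centre? (∈-allFin c) y∈A)
                                 (inB T′∈F′ (∈-image⁺ im′ c∈S) (∈-image⁺ im′ x∈S)))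

-- Images of edges and enumeration of the potential copies

hit? : ∀ (f : Fin m → Fin n) S y → Dec (∃ λ x → x ∈ S × f x ≡ y)
hit? f S y = any? λ x → x ∈? S ×-dec f x ≟ y

image : (Fin m → Fin n) → Subset m → Subset n
image f S = Vec.tabulate (does ∘ hit? f S)

image-isImage : ∀ (f : Fin m → Fin n) S → IsImage f S (image f S)
image-isImage f S y = mk⇔ to from
  where
  lookup-image : Vec.lookup (image f S) y ≡ does (hit? f S y)
  lookup-image = Vec.lookup∘tabulate (does ∘ hit? f S) y
  to : y ∈ image f S → ∃ λ x → x ∈ S × f x ≡ y
  to y∈ with hit? f S y | trans (sym lookup-image) (Vec.[]=⇒lookup y∈)
  ... | yes hit | _ = hit
  ... | no _    | ()
  from : (∃ λ x → x ∈ S × f x ≡ y) → y ∈ image f S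
  from hit = Vec.lookup⇒[]= y (image f S) (trans lookup-image (dec-true (hit? f S y) hit))

-- Agreement on `S` suffices, so a copy may be altered off the support of `H` without moving any
-- edge.
isImage-unique : ∀ {f g : Fin m → Fin n} {S T T′} → (∀ {x} → x ∈ S → f x ≡ g x) →
  IsImage f S T → IsImage g S T′ → T ≡ T′
isImage-unique {f = f} {g} {S} f≗g im im′ = ⊆-antisym
  (λ {y} y∈T → let x , x∈S , eq = Equivalence.to (im y) y∈T in
    Equivalence.from (im′ y) (x , x∈S , trans (sym (f≗g x∈S)) eq))
  (λ {y} y∈T′ → let x , x∈S , eq = Equivalence.to (im′ y) y∈T′ in
    Equivalence.from (im y) (x , x∈S , trans (f≗g x∈S) eq))

image-injective : ∀ {f : Fin m → Fin n} → Injective _≡_ _≡_ f → Injective _≡_ _≡_ (image f)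
image-injective {f = f} inj {S} {S′} eq = ⊆-antisym (half eq) (half (sym eq))
  where
  half : ∀ {S S′ x} → image f S ≡ image f S′ → x ∈ S → x ∈ S′
  half {S} {S′} {x} eq x∈S
    with y , y∈S′ , fy≡fx ← Equivalence.to (image-isImage f S′ (f x)) (subst (f x ∈_) eq (∈-image⁺ (image-isImage f S) x∈S))
    = subst (_∈ S′) (inj fy≡fx) y∈S′

-- Vertices off the list receive the default value `z`. Applied to the support, this leaves n^v maps
-- to consider rather than n^m.
assignments : Fin n → List (Fin m) → List (Fin m → Fin n)
assignments z []       = [ const z ]
assignments z (x ∷ xs) = cartesianProductWith (λ y φ → updateAt φ x (const y)) (allFin _) (assignments z xs)

length-assignments : ∀ (z : Fin n) (xs : List (Fin m)) → length (assignments z xs) ≡ n ^ length xs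
length-assignments z []       = refl
length-assignments {n} z (x ∷ xs) =
  trans (length-product (allFin n)) (cong₂ _*_ (length-tabulate {n = n} id) (length-assignments z xs))
  where
  length-product : ∀ ys → length (cartesianProductWith (λ y φ → updateAt φ x (const y)) ys (assignments z xs)) ≡
                     length ys * length (assignments z xs)
  length-product []       = refl
  length-product (y ∷ ys) = trans (length-++ (map _ (assignments z xs)))
    (cong₂ _+_ (length-map _ (assignments z xs)) (length-product ys))

assignments-complete : ∀ (z : Fin n) (f : Fin m → Fin n) xs →
  ∃ λ φ → φ ∈ˡ assignments z xs × (∀ {x} → x ∈ˡ xs → φ x ≡ f x)
assignments-complete z f []       = const z , here refl , λ ()
assignments-complete z f (x ∷ xs) with assignments-complete z f xs
... | φ , φ∈ , φ≗f = updateAt φ x (const (f x)) ,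
    ∈-cartesianProductWith⁺ (λ y φ → updateAt φ x (const y)) (∈-allFin (f x)) φ∈ , agree
  where
  agree : ∀ {y} → y ∈ˡ x ∷ xs → updateAt φ x (const (f x)) y ≡ f y
  agree (here refl) = updateAt-updates x φ
  agree {y} (there y∈xs) with y ≟ x
  -- If `x` recurs in the tail, the update overwrites its value with the same `f x`.
  ... | yes refl = updateAt-updates x φ
  ... | no y≢x   = trans (updateAt-minimal y x φ y≢x) (φ≗f y∈xs)

-- Union bound: were the inequality to fail, the greedy deletion would leave e of the binom(n,4) possible edges
-- containing none of the at most n^|support H| potential copies of H.
unavoidable-bound : ∀ {e} {H : Graph4 m} → Fin n → Unavoidable n e H → 0 < e → e ≤ n C 4 →
  (n C 4) ^ numEdges H ≤ n ^ length (support H) * e ^ numEdges H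
unavoidable-bound {m} {n} {e} {H} z un 0<e e≤N = ≮⇒≥ impossible
  where
  _≟ˢ_ : DecidableEquality (Subset n)
  _≟ˢ_ = Vec.≡-dec Bool._≟_
  open import Data.List.Relation.Unary.Unique.DecPropositional _≟ˢ_ using (unique?)
  open import Data.List.Relation.Binary.Subset.DecPropositional _≟ˢ_ using (_⊆?_)
  u = numEdges H
  K = complete n 4
  copyAlong : (Fin m → Fin n) → List (Subset n)
  copyAlong φ = map (image φ) (edges H)
  candidates : List (List (Subset n))
  candidates = map copyAlong (assignments z (support H))
  -- Candidate maps need not be injective: image edges may coincide or have fewer than four
  -- vertices. The filter keeps the lists to which `avoid` applies.
  uniformIn? : Decidable (UniformIn u (members K))
  uniformIn? E = unique? E ×-dec length E ≟ℕ u ×-dec E ⊆? members K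
  copies : List (List (Subset n))
  copies = filter uniformIn? candidates
  length-copies : length copies ≤ n ^ length (support H)
  length-copies = ≤-trans (length-filter uniformIn? candidates) (≤-reflexive
    (trans (length-map copyAlong (assignments z (support H))) (length-assignments z (support H))))
  impossible : ¬ n ^ length (support H) * e ^ u < (n C 4) ^ u
  impossible small
    with avoid _≟ˢ_ {u = u} (n C 4 ∸ e) copies 0<e (distinct K) (trans (length-complete n 4) (sym (m∸n+n≡m e≤N)))
           (All.tabulate (proj₂ ∘ ∈-filter⁻ uniformIn? {xs = candidates}))
           (≤-<-trans (*-monoˡ-≤ (e ^ u) length-copies) (subst (λ N → n ^ length (support H) * e ^ u < N ^ u) (sym (length-complete n 4)) small))
  ... | G′ , uG′ , G′⊆K , lenG′ , none
    -- The surviving `e` sets form a graph, so `un` yields a copy along some `f`. A listed `φ`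
    -- agrees with `f` on the support, which puts the copied edges among `copies` and contradicts
    -- `none`.
    with un (record { edges = G′ ; unique = uG′ ; uniform = All.tabulate (All.lookup (sized K) ∘ G′⊆K) }) lenG′
  ...   | f , inj , copy with assignments-complete z f (support H)
  ...     | φ , φ∈ , φ≗f = All.lookup none E∈copies E⊆G′
    where
    image-f≡image-φ : ∀ {S} → S ∈ˡ edges H → image f S ≡ image φ S
    image-f≡image-φ {S} S∈H = isImage-unique (λ x∈S → sym (φ≗f (∈-support⁺ H S∈H x∈S)))
      (image-isImage f S) (image-isImage φ S)
    copyAlong-f≡copyAlong-φ : copyAlong f ≡ copyAlong φ
    copyAlong-f≡copyAlong-φ = map-cong-local (All.tabulate image-f≡image-φ)
    E⊆G′ : copyAlong f ⊆ˡ G′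
    E⊆G′ T∈ with ∈-map⁻ (image f) T∈
    ... | S , S∈H , refl with find (All.lookup copy S∈H)
    ...   | T , T∈G′ , im = subst (_∈ˡ G′) (isImage-unique (λ _ → refl) im (image-isImage f S)) T∈G′
    E∈copies : copyAlong f ∈ˡ copies
    E∈copies = ∈-filter⁺ uniformIn?
      (subst (_∈ˡ candidates) (sym copyAlong-f≡copyAlong-φ) (∈-map⁺ copyAlong φ∈))
      (Unique.map⁺ (image-injective inj) (unique H) , length-map (image f) (edges H) , G′⊆K ∘ E⊆G′)

-- Choice of the parameters

^-distribʳ-* : ∀ k m n → (m * n) ^ k ≡ m ^ k * n ^ k
^-distribʳ-* zero    m n = refl
^-distribʳ-* (suc k) m n = trans (cong (m * n *_) (^-distribʳ-* k m n)) (arith m n (m ^ k) (n ^ k))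
  where
  arith : ∀ a b c d → a * b * (c * d) ≡ a * c * (b * d)
  arith = solve-∀

^-cancelˡ-≤ : ∀ k .{{_ : NonZero k}} {m n} → m ^ k ≤ n ^ k → m ≤ n
^-cancelˡ-≤ k mᵏ≤nᵏ = ≮⇒≥ λ n<m → <⇒≱ (^-monoˡ-< k n<m) mᵏ≤nᵏ

^-swap : ∀ m j k → (m ^ j) ^ k ≡ (m ^ k) ^ j
^-swap m j k = trans (^-*-assoc m j k) (trans (cong (m ^_) (*-comm j k)) (sym (^-*-assoc m k j)))

-- Used to choose sizes: success at `suc t` gives room for enough edges, failure at `t` bounds the
-- size from above.
first-step : ∀ {P : ℕ → Set} → Decidable P → ∀ n → ¬ P 0 → P n → ∃ λ t → t < n × ¬ P t × P (suc t)
first-step P? zero    ¬p0 pn = contradiction pn ¬p0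
first-step P? (suc n) ¬p0 pn with P? n
... | yes p = let t , t<n , ¬pt , pt+1 = first-step P? n ¬p0 p in t , m<n⇒m<1+n t<n , ¬pt , pt+1
... | no ¬p = n , ≤-refl , ¬p , pn

-- Estimates for binomial coefficients

2*nC2 : ∀ p → 2 * ((2 + p) C 2) ≡ (2 + p) * (1 + p)
2*nC2 zero    = refl
2*nC2 (suc p) = begin
  2 * ((3 + p) C 2)                         ≡⟨ cong (2 *_) (nCk+nC[k+1]≡[n+1]C[k+1] (2 + p) 1) ⟨
  2 * ((2 + p) C 1 + (2 + p) C 2)           ≡⟨ *-distribˡ-+ 2 ((2 + p) C 1) _ ⟩
  2 * ((2 + p) C 1) + 2 * ((2 + p) C 2)     ≡⟨ cong₂ _+_ (cong (2 *_) (nC1≡n (2 + p))) (2*nC2 p) ⟩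
  2 * (2 + p) + (2 + p) * (1 + p)           ≡⟨ arith p ⟩
  (3 + p) * (2 + p)                         ∎
  where
  open ≡-Reasoning
  arith : ∀ p → 2 * (2 + p) + (2 + p) * (1 + p) ≡ (3 + p) * (2 + p)
  arith = solve-∀

6*nC3 : ∀ p → 6 * ((3 + p) C 3) ≡ (3 + p) * (2 + p) * (1 + p)
6*nC3 zero    = refl
6*nC3 (suc p) = begin
  6 * ((4 + p) C 3)                               ≡⟨ cong (6 *_) (nCk+nC[k+1]≡[n+1]C[k+1] (3 + p) 2) ⟨
  6 * ((3 + p) C 2 + (3 + p) C 3)                 ≡⟨ arith₁ ((3 + p) C 2) ((3 + p) C 3) ⟩
  3 * (2 * ((3 + p) C 2)) + 6 * ((3 + p) C 3)     ≡⟨ cong₂ _+_ (cong (3 *_) (2*nC2 (suc p))) (6*nC3 p) ⟩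
  3 * ((3 + p) * (2 + p)) + (3 + p) * (2 + p) * (1 + p)  ≡⟨ arith₂ p ⟩
  (4 + p) * (3 + p) * (2 + p)                     ∎
  where
  open ≡-Reasoning
  arith₁ : ∀ x y → 6 * (x + y) ≡ 3 * (2 * x) + 6 * y
  arith₁ = solve-∀
  arith₂ : ∀ p → 3 * ((3 + p) * (2 + p)) + (3 + p) * (2 + p) * (1 + p) ≡ (4 + p) * (3 + p) * (2 + p)
  arith₂ = solve-∀

24*nC4 : ∀ p → 24 * ((4 + p) C 4) ≡ (4 + p) * (3 + p) * (2 + p) * (1 + p)
24*nC4 zero    = refl
24*nC4 (suc p) = begin
  24 * ((5 + p) C 4)                               ≡⟨ cong (24 *_) (nCk+nC[k+1]≡[n+1]C[k+1] (4 + p) 3) ⟨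
  24 * ((4 + p) C 3 + (4 + p) C 4)                 ≡⟨ arith₁ ((4 + p) C 3) ((4 + p) C 4) ⟩
  4 * (6 * ((4 + p) C 3)) + 24 * ((4 + p) C 4)     ≡⟨ cong₂ _+_ (cong (4 *_) (6*nC3 (suc p))) (24*nC4 p) ⟩
  4 * ((4 + p) * (3 + p) * (2 + p)) + (4 + p) * (3 + p) * (2 + p) * (1 + p)  ≡⟨ arith₂ p ⟩
  (5 + p) * (4 + p) * (3 + p) * (2 + p)            ∎
  where
  open ≡-Reasoning
  arith₁ : ∀ x y → 24 * (x + y) ≡ 4 * (6 * x) + 24 * y
  arith₁ = solve-∀
  arith₂ : ∀ p → 4 * ((4 + p) * (3 + p) * (2 + p)) + (4 + p) * (3 + p) * (2 + p) * (1 + p) ≡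
                 (5 + p) * (4 + p) * (3 + p) * (2 + p)
  arith₂ = solve-∀

-- A case of binom(n,k) ≥ (n/k)^k, as is `n⁴≤256*nC4`. With n = 3 + p, six times the difference is a
-- polynomial in p with nonnegative coefficients.
n³≤27*nC3 : ∀ {n} → 3 ≤ n → n ^ 3 ≤ 27 * (n C 3)
n³≤27*nC3 (s≤s (s≤s (s≤s {n = p} z≤n))) = *-cancelˡ-≤ 6 (begin
  6 * (3 + p) ^ 3                              ≤⟨ m≤m+n _ _ ⟩
  6 * (3 + p) ^ 3 + (3 + p) * (21 * p * p + 45 * p)  ≡⟨ arith p ⟩
  27 * ((3 + p) * (2 + p) * (1 + p))           ≡⟨ cong (27 *_) (6*nC3 p) ⟨
  27 * (6 * ((3 + p) C 3))                     ≡⟨ swap ((3 + p) C 3) ⟩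
  6 * (27 * ((3 + p) C 3))                     ∎)
  where
  open ≤-Reasoning
  arith : ∀ p → 6 * ((3 + p) * ((3 + p) * ((3 + p) * 1))) + (3 + p) * (21 * p * p + 45 * p) ≡
                27 * ((3 + p) * (2 + p) * (1 + p))
  arith = solve-∀
  swap : ∀ x → 27 * (6 * x) ≡ 6 * (27 * x)
  swap = solve-∀

n⁴≤256*nC4 : ∀ {n} → 4 ≤ n → n ^ 4 ≤ 256 * (n C 4)
n⁴≤256*nC4 (s≤s (s≤s (s≤s (s≤s {n = p} z≤n)))) = *-cancelˡ-≤ 24 (begin
  24 * (4 + p) ^ 4                              ≤⟨ m≤m+n _ _ ⟩
  24 * (4 + p) ^ 4 + 8 * (4 + p) * (29 * p * p * p + 156 * p * p + 208 * p)  ≡⟨ arith p ⟩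
  256 * ((4 + p) * (3 + p) * (2 + p) * (1 + p))  ≡⟨ cong (256 *_) (24*nC4 p) ⟨
  256 * (24 * ((4 + p) C 4))                     ≡⟨ swap ((4 + p) C 4) ⟩
  24 * (256 * ((4 + p) C 4))                     ∎)
  where
  open ≤-Reasoning
  arith : ∀ p → 24 * ((4 + p) * ((4 + p) * ((4 + p) * ((4 + p) * 1)))) +
                8 * (4 + p) * (29 * p * p * p + 156 * p * p + 208 * p) ≡
                256 * ((4 + p) * (3 + p) * (2 + p) * (1 + p))
  arith = solve-∀
  swap : ∀ x → 256 * (24 * x) ≡ 24 * (256 * x)
  swap = solve-∀

-- The predecessor t of the chosen size has t^4 ≤ 256 binom(t,4) ≤ 256 e. Passing from t to t + 1 ≤
-- 2t costs a factor 16, and 16 · 256 = 8^4.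
clique-size : ∀ {n e} → 0 < e → e ≤ n C 4 → ∃ λ t → t ≤ n × e ≤ t C 4 × t ^ 4 ≤ 8 ^ 4 * e
clique-size {n} {e} 0<e e≤N with first-step (λ t → e ≤? t C 4) n (<⇒≱ 0<e) e≤N
... | t , t<n , few , enough = suc t , t<n , enough , small
  where
  open ≤-Reasoning
  few′ : t C 4 ≤ e
  few′ = <⇒≤ (≰⇒> few)
  small : suc t ^ 4 ≤ 8 ^ 4 * e
  small with 4 ≤? t
  ... | yes 4≤t = begin
    suc t ^ 4            ≤⟨ ^-monoˡ-≤ 4 (+-monoˡ-≤ t (≤-trans (s≤s z≤n) 4≤t)) ⟩
    (t + t) ^ 4          ≡⟨ arith t ⟩
    16 * t ^ 4           ≤⟨ *-monoʳ-≤ 16 (n⁴≤256*nC4 4≤t) ⟩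
    16 * (256 * (t C 4)) ≡⟨ *-assoc 16 256 (t C 4) ⟨
    8 ^ 4 * (t C 4)      ≤⟨ *-monoʳ-≤ (8 ^ 4) few′ ⟩
    8 ^ 4 * e            ∎
    where
    arith : ∀ t → (t + t) * ((t + t) * ((t + t) * ((t + t) * 1))) ≡ 16 * (t * (t * (t * (t * 1))))
    arith = solve-∀
  ... | no 4≰t = begin
    suc t ^ 4  ≤⟨ ^-monoˡ-≤ 4 (≤-trans (≰⇒> 4≰t) (m≤m+n 4 4)) ⟩
    8 ^ 4      ≤⟨ m≤m*n (8 ^ 4) e {{>-nonZero 0<e}} ⟩
    8 ^ 4 * e  ∎

-- 216 = 8 · 27 makes up for (n ∸ a)^3 ≥ n^3/8 and binom(r,3) ≥ r^3/27.
star-size : ∀ {n e} → 6 ≤ n → n ^ 3 ≤ e → 1024 * e ≤ n ^ 4 →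
  ∃ λ a → a ≤ n × e ≤ a * ((n ∸ a) C 3) × a * n ^ 3 ≤ 432 * e
star-size {n} {e} 6≤n n³≤e 1024e≤n⁴ = a , a≤n , enough , small
  where
  open ≤-Reasoning
  instance
    n≢0 : NonZero n
    n≢0 = >-nonZero (≤-trans (s≤s z≤n) 6≤n)
    n³≢0 : NonZero (n ^ 3)
    n³≢0 = m^n≢0 n 3
  d = e / n ^ 3
  a = 216 * suc d
  r = n ∸ a
  -- Since d ≥ 1, rounding up to `suc d` at most doubles it, whence 432 = 2 · 216.
  small : a * n ^ 3 ≤ 432 * e
  small = begin
    216 * suc d * n ^ 3      ≤⟨ *-monoˡ-≤ (n ^ 3) (*-monoʳ-≤ 216 (+-monoˡ-≤ d (m≥n⇒m/n>0 n³≤e))) ⟩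
    216 * (d + d) * n ^ 3    ≡⟨ arith d (n ^ 3) ⟩
    432 * (d * n ^ 3)        ≤⟨ *-monoʳ-≤ 432 (m/n*n≤m e (n ^ 3)) ⟩
    432 * e                  ∎
    where
    arith : ∀ d x → 216 * (d + d) * x ≡ 432 * (d * x)
    arith = solve-∀
  -- As 2 · 432 = 864 ≤ 1024, the centres take up at most half of the vertices, so r ≥ n/2.
  2a≤n : 2 * a ≤ n
  2a≤n = *-cancelʳ-≤ (2 * a) n (n ^ 3) (begin
    2 * a * n ^ 3    ≡⟨ *-assoc 2 a (n ^ 3) ⟩
    2 * (a * n ^ 3)  ≤⟨ *-monoʳ-≤ 2 small ⟩
    2 * (432 * e)    ≡⟨ *-assoc 2 432 e ⟨
    864 * e          ≤⟨ *-monoˡ-≤ e (m≤m+n 864 160) ⟩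
    1024 * e         ≤⟨ 1024e≤n⁴ ⟩
    n ^ 4            ∎)
  a≤n : a ≤ n
  a≤n = ≤-trans (m≤n*m a 2) 2a≤n
  n≤2r : n ≤ 2 * r
  n≤2r = +-cancelˡ-≤ n _ _ (begin
    n + n                ≡⟨ cong₂ _+_ (m+[n∸m]≡n a≤n) (m+[n∸m]≡n a≤n) ⟨
    (a + r) + (a + r)    ≡⟨ arith a r ⟩
    2 * a + 2 * r        ≤⟨ +-monoˡ-≤ (2 * r) 2a≤n ⟩
    n + 2 * r            ∎)
    where
    arith : ∀ a r → (a + r) + (a + r) ≡ 2 * a + 2 * r
    arith = solve-∀
  enough : e ≤ a * (r C 3)
  enough = begin
    e                            ≡⟨ m≡m%n+[m/n]*n e (n ^ 3) ⟩
    e % n ^ 3 + d * n ^ 3        ≤⟨ +-monoˡ-≤ (d * n ^ 3) (<⇒≤ (m%n<n e (n ^ 3))) ⟩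
    suc d * n ^ 3                ≤⟨ *-monoʳ-≤ (suc d) (^-monoˡ-≤ 3 n≤2r) ⟩
    suc d * (2 * r) ^ 3          ≡⟨ cong (suc d *_) (^-distribʳ-* 3 2 r) ⟩
    suc d * (8 * r ^ 3)          ≤⟨ *-monoʳ-≤ (suc d) (*-monoʳ-≤ 8 (n³≤27*nC3 {r} (*-cancelˡ-≤ 2 (≤-trans 6≤n n≤2r)))) ⟩
    suc d * (8 * (27 * (r C 3))) ≡⟨ arith (suc d) (r C 3) ⟩
    216 * suc d * (r C 3)        ∎
    where
    arith : ∀ d x → d * (8 * (27 * x)) ≡ 216 * d * x
    arith = solve-∀

-- 512 = 2 · 256 makes up for ⌊n/s⌋ ≥ n/(2s) and binom(s,4) ≥ s^4/256.
block-size : ∀ {n e} → 0 < n → n ^ 3 ≤ e → 512 * e ≤ n ^ 4 →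
  ∃ λ q → ∃ λ s → q * s ≤ n × e ≤ q * (s C 4) × n * s ^ 3 ≤ 4096 * e
block-size {n} {e} 0<n n³≤e 512e≤n⁴
  with first-step (λ s → 512 * e ≤? n * s ^ 3) n none 512e≤n⁴
  where
  none : ¬ 512 * e ≤ n * 0
  none 512e≤ = <⇒≱ 0<n (^-cancelˡ-≤ 3 (≤-trans n³≤e (≤-trans (m≤n*m e 512) (≤-trans 512e≤ (≤-reflexive (*-zeroʳ n))))))
... | s′ , s′<n , few , 512e≤ns³ = q , s , m/n*n≤m n s , enough , small
  where
  open ≤-Reasoning
  s = suc s′
  q = n / s
  instance
    n≢0 : NonZero n
    n≢0 = >-nonZero 0<n
  -- From 512 n ≤ 512 e ≤ n s^3. This makes `s` large enough for the estimate of binom(s,4) and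
  -- gives s ≤ 2s′.
  8≤s : 8 ≤ s
  8≤s = ^-cancelˡ-≤ 3 (*-cancelˡ-≤ n (begin
    n * 512          ≡⟨ *-comm n 512 ⟩
    512 * n          ≤⟨ *-monoʳ-≤ 512 (≤-trans (m≤m*n n (n ^ 2) {{m^n≢0 n 2}}) n³≤e) ⟩
    512 * e          ≤⟨ 512e≤ns³ ⟩
    n * s ^ 3        ∎))
  -- The size `s′` was too small, and s^3 ≤ 8 s′^3; here 8 · 512 = 4096 = 16^3.
  small : n * s ^ 3 ≤ 4096 * e
  small = begin
    n * s ^ 3           ≤⟨ *-monoʳ-≤ n (^-monoˡ-≤ 3 (+-monoˡ-≤ s′ (s≤s⁻¹ (≤-trans (m≤m+n 2 6) 8≤s)))) ⟩
    n * (s′ + s′) ^ 3   ≡⟨ arith n s′ ⟩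
    8 * (n * s′ ^ 3)    ≤⟨ *-monoʳ-≤ 8 (<⇒≤ (≰⇒> few)) ⟩
    8 * (512 * e)       ≡⟨ *-assoc 8 512 e ⟨
    4096 * e            ∎
    where
    arith : ∀ n s → n * ((s + s) * ((s + s) * ((s + s) * 1))) ≡ 8 * (n * (s * (s * (s * 1))))
    arith = solve-∀
  -- As s ≤ n, there is at least one block, so the leftover vertices, fewer than `s`, are fewer than
  -- `q * s`.
  n≤2qs : n ≤ q * s + q * s
  n≤2qs = begin
    n                ≡⟨ m≡m%n+[m/n]*n n s ⟩
    n % s + q * s    ≤⟨ +-monoˡ-≤ (q * s) (<⇒≤ (m%n<n n s)) ⟩
    s + q * s        ≤⟨ +-monoˡ-≤ (q * s) (m≤n*m s q {{>-nonZero (m≥n⇒m/n>0 s′<n)}}) ⟩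
    q * s + q * s    ∎
  enough : e ≤ q * (s C 4)
  enough = *-cancelˡ-≤ 512 (begin
    512 * e                      ≤⟨ 512e≤ns³ ⟩
    n * s ^ 3                    ≤⟨ *-monoˡ-≤ (s ^ 3) n≤2qs ⟩
    (q * s + q * s) * s ^ 3      ≡⟨ arith₁ q s (s ^ 3) ⟩
    2 * q * s ^ 4                ≤⟨ *-monoʳ-≤ (2 * q) (n⁴≤256*nC4 (≤-trans (m≤m+n 4 4) 8≤s)) ⟩
    2 * q * (256 * (s C 4))      ≡⟨ arith₂ q (s C 4) ⟩
    512 * (q * (s C 4))          ∎)
    where
    arith₁ : ∀ q s x → (q * s + q * s) * x ≡ 2 * q * (s * x)
    arith₁ = solve-∀
    arith₂ : ∀ q x → 2 * q * (256 * x) ≡ 512 * (q * x)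
    arith₂ = solve-∀

-- From the bounds on the support to the bounds on the edges

log-bound : ∀ {n N e u v D} → 0 < n → 0 < e → 0 < D → N ^ u ≤ n ^ v * e ^ u → v ^ 4 ≤ D ^ 4 * e →
  ∀ a b → a ^ 4 * D ^ 4 * e ≤ b ^ 4 * u ^ 4 → N ^ a ≤ n ^ b * e ^ a
-- For u = 0 there is no root to take, but then the premise forces a = 0.
log-bound {n} {u = zero} 0<n 0<e 0<D _ _ zero b _ = ≤-trans (m^n>0 n {{>-nonZero 0<n}} b) (≤-reflexive (sym (*-identityʳ _)))
log-bound {e = e} {zero} {D = D} 0<n 0<e 0<D _ _ (suc a) b h =
  contradiction (≤-trans h (≤-reflexive (*-zeroʳ (b ^ 4))))
    (<⇒≱ (*-mono-< (*-mono-< (^-monoˡ-< 4 (z<s {a})) (^-monoˡ-< 4 0<D)) 0<e))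
-- Raise the random-graph bound to the power `a`, replace a v by b u, and take `u`-th roots.
log-bound {n} {N} {e} {u@(suc _)} {v} {D} 0<n 0<e 0<D bound v⁴≤ a b h = ^-cancelˡ-≤ u (begin
  (N ^ a) ^ u                ≡⟨ ^-swap N a u ⟩
  (N ^ u) ^ a                ≤⟨ ^-monoˡ-≤ a bound ⟩
  (n ^ v * e ^ u) ^ a        ≡⟨ ^-distribʳ-* a (n ^ v) (e ^ u) ⟩
  (n ^ v) ^ a * (e ^ u) ^ a  ≡⟨ cong₂ _*_ (trans (^-*-assoc n v a) (cong (n ^_) (*-comm v a))) (^-swap e u a) ⟩
  n ^ (a * v) * (e ^ a) ^ u  ≤⟨ *-monoˡ-≤ _ (^-monoʳ-≤ n {{>-nonZero 0<n}} av≤bu) ⟩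
  n ^ (b * u) * (e ^ a) ^ u  ≡⟨ cong (_* (e ^ a) ^ u) (^-*-assoc n b u) ⟨
  (n ^ b) ^ u * (e ^ a) ^ u  ≡⟨ ^-distribʳ-* u (n ^ b) (e ^ a) ⟨
  (n ^ b * e ^ a) ^ u        ∎)
  where
  open ≤-Reasoning
  av≤bu : a * v ≤ b * u
  av≤bu = ^-cancelˡ-≤ 4 (begin
    (a * v) ^ 4          ≡⟨ ^-distribʳ-* 4 a v ⟩
    a ^ 4 * v ^ 4        ≤⟨ *-monoʳ-≤ (a ^ 4) v⁴≤ ⟩
    a ^ 4 * (D ^ 4 * e)  ≡⟨ *-assoc (a ^ 4) (D ^ 4) e ⟨
    a ^ 4 * D ^ 4 * e    ≤⟨ h ⟩
    b ^ 4 * u ^ 4        ≡⟨ ^-distribʳ-* 4 b u ⟨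
    (b * u) ^ 4          ∎)

-- As N/e ≥ n^(12/13), the random-graph bound gives n^(12u/13) ≤ n^v. Hence 12u ≤ 13v, relaxed to
-- 24v for an integral factor.
sparse-bound : ∀ {n N e u v} → 1 < n → 0 < e → e ^ 13 * n ^ 12 ≤ N ^ 13 → N ^ u ≤ n ^ v * e ^ u → u ≤ 2 * v
sparse-bound {n} {N} {e} {u} {v} 1<n 0<e sparse bound = *-cancelˡ-≤ 12 (begin
  12 * u        ≤⟨ ≮⇒≥ (λ lt → <⇒≱ (^-monoʳ-< n 1<n lt) n^12u≤n^13v) ⟩
  v * 13        ≤⟨ *-monoʳ-≤ v (m≤m+n 13 11) ⟩
  v * 24        ≡⟨ *-comm v 24 ⟩
  24 * v        ≡⟨ *-assoc 12 2 v ⟩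
  12 * (2 * v)  ∎)
  where
  open ≤-Reasoning
  instance
    e^13^u≢0 : NonZero ((e ^ 13) ^ u)
    e^13^u≢0 = m^n≢0 (e ^ 13) u {{m^n≢0 e 13 {{>-nonZero 0<e}}}}
  n^12u≤n^13v : n ^ (12 * u) ≤ n ^ (v * 13)
  n^12u≤n^13v = *-cancelˡ-≤ ((e ^ 13) ^ u) (begin
    (e ^ 13) ^ u * n ^ (12 * u)    ≡⟨ cong ((e ^ 13) ^ u *_) (^-*-assoc n 12 u) ⟨
    (e ^ 13) ^ u * (n ^ 12) ^ u    ≡⟨ ^-distribʳ-* u (e ^ 13) (n ^ 12) ⟨
    (e ^ 13 * n ^ 12) ^ u          ≤⟨ ^-monoˡ-≤ u sparse ⟩
    (N ^ 13) ^ u                   ≡⟨ ^-swap N 13 u ⟩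
    (N ^ u) ^ 13                   ≤⟨ ^-monoˡ-≤ 13 bound ⟩
    (n ^ v * e ^ u) ^ 13           ≡⟨ ^-distribʳ-* 13 (n ^ v) (e ^ u) ⟩
    (n ^ v) ^ 13 * (e ^ u) ^ 13    ≡⟨ cong₂ _*_ (^-*-assoc n v 13) (^-swap e u 13) ⟩
    n ^ (v * 13) * (e ^ 13) ^ u    ≡⟨ *-comm (n ^ (v * 13)) _ ⟩
    (e ^ 13) ^ u * n ^ (v * 13)    ∎)

range-bound : ∀ c {n e} → 0 < n → c ^ 13 * e ^ 13 ≤ n ^ 40 → c * e ≤ n ^ 4
range-bound c {n} {e} 0<n e≤ = ^-cancelˡ-≤ 13 (begin
  (c * e) ^ 13     ≡⟨ ^-distribʳ-* 13 c e ⟩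
  c ^ 13 * e ^ 13  ≤⟨ e≤ ⟩
  n ^ 40           ≤⟨ ^-monoʳ-≤ n {{>-nonZero 0<n}} (m≤m+n 40 12) ⟩
  n ^ 52           ≡⟨ ^-*-assoc n 4 13 ⟨
  (n ^ 4) ^ 13     ∎)
  where open ≤-Reasoning

-- The exponent 12/13 is the gap 4 - 40/13, and c ≥ 256 absorbs the loss between n^4 and binom(n,4).
range-sparse : ∀ c {n e} → 256 ≤ c → 4 ≤ n → c ^ 13 * e ^ 13 ≤ n ^ 40 → e ^ 13 * n ^ 12 ≤ (n C 4) ^ 13
range-sparse c {n} {e} 256≤c 4≤n e≤ = *-cancelˡ-≤ (c ^ 13) {{m^n≢0 c 13 {{>-nonZero (≤-trans z<s 256≤c)}}}} (begin
  c ^ 13 * (e ^ 13 * n ^ 12)  ≡⟨ *-assoc (c ^ 13) (e ^ 13) (n ^ 12) ⟨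
  c ^ 13 * e ^ 13 * n ^ 12    ≤⟨ *-monoˡ-≤ (n ^ 12) e≤ ⟩
  n ^ 40 * n ^ 12             ≡⟨ ^-distribˡ-+-* n 40 12 ⟨
  n ^ 52                      ≡⟨ ^-*-assoc n 4 13 ⟨
  (n ^ 4) ^ 13                ≤⟨ ^-monoˡ-≤ 13 (≤-trans (n⁴≤256*nC4 4≤n) (*-monoˡ-≤ (n C 4) 256≤c)) ⟩
  (c * (n C 4)) ^ 13          ≡⟨ ^-distribʳ-* 13 c (n C 4) ⟩
  c ^ 13 * (n C 4) ^ 13       ∎)
  where open ≤-Reasoning

-- In the cube of u ≤ 2 a s, write n^10 = (n^3)^3 n: the three factors `a` take one n^3 each, and
-- s^3 takes the last n.
edges-bound : ∀ α β {n e u v a s} → a * n ^ 3 ≤ α * e → n * s ^ 3 ≤ β ^ 3 * e → v ≤ a * s → u ≤ 2 * v →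
  u ^ 3 * n ^ 10 ≤ (2 * α * β) ^ 3 * e ^ 4
edges-bound α β {n} {e} {u} {v} {a} {s} a≤ s≤ v≤as u≤2v = begin
  u ^ 3 * n ^ 10                           ≤⟨ *-monoˡ-≤ (n ^ 10) (^-monoˡ-≤ 3 (≤-trans u≤2v (*-monoʳ-≤ 2 v≤as))) ⟩
  (2 * (a * s)) ^ 3 * n ^ 10
    ≡⟨ cong₂ _*_ (cube a s) (trans (cong (n *_) (sym (^-*-assoc n 3 3))) (*-comm n ((n ^ 3) ^ 3))) ⟩
  8 * a ^ 3 * s ^ 3 * ((n ^ 3) ^ 3 * n)    ≡⟨ regroup (a ^ 3) (s ^ 3) ((n ^ 3) ^ 3) n ⟩
  8 * (a ^ 3 * (n ^ 3) ^ 3) * (n * s ^ 3)  ≡⟨ cong (λ x → 8 * x * (n * s ^ 3)) (^-distribʳ-* 3 a (n ^ 3)) ⟨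
  8 * (a * n ^ 3) ^ 3 * (n * s ^ 3)        ≤⟨ *-mono-≤ (*-monoʳ-≤ 8 (^-monoˡ-≤ 3 a≤)) s≤ ⟩
  8 * (α * e) ^ 3 * (β ^ 3 * e)            ≡⟨ collect α β e ⟩
  (2 * α * β) ^ 3 * e ^ 4                  ∎
  where
  open ≤-Reasoning
  cube : ∀ a s → 2 * (a * s) * (2 * (a * s) * (2 * (a * s) * 1)) ≡ 8 * (a * (a * (a * 1))) * (s * (s * (s * 1)))
  cube = solve-∀
  regroup : ∀ p q r n → 8 * p * q * (r * n) ≡ 8 * (p * r) * (n * q)
  regroup = solve-∀
  collect : ∀ α β e → 8 * (α * e * (α * e * (α * e * 1))) * (β * (β * (β * 1)) * e) ≡
    2 * α * β * (2 * α * β * (2 * α * β * 1)) * (e * (e * (e * (e * 1))))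
  collect = solve-∀

-- Here 1 / `suc k` is the constant c0; `suc k` ≥ 1024 meets the requirements 1024, 512 and 256 of
-- the star, the blocks and `range-sparse`.
sparse-case : ∀ k n e → 1023 ≤ k → 6 ≤ n → 1 * n ^ 3 ≤ e → suc k ^ 13 * e ^ 13 ≤ n ^ 40 →
  ∀ m (H : Graph4 m) → Unavoidable n e H → numEdges H ^ 3 * n ^ 10 ≤ (2 * 432 * 16) ^ 3 * e ^ 4
sparse-case k n e 1023≤k 6≤n 1*n³≤e e≤ m H un =
  let a , a≤n , e≤star , a≤ = star-size 6≤n n³≤e 1024e≤n⁴
      q , s , qs≤n , e≤blocks , s≤ = block-size 0<n n³≤e (≤-trans (*-monoˡ-≤ e (m≤m+n 512 512)) 1024e≤n⁴)
  in edges-bound 432 16 {n} {e} {numEdges H} {length (support H)} {a} {s} a≤ s≤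
       (star-blocks-support {H = H} a q s un a≤n e≤star qs≤n e≤blocks)
       (sparse-bound {e = e} {u = numEdges H} {length (support H)} (≤-trans (m≤m+n 2 4) 6≤n) 0<e e¹³n¹²≤N¹³
         (unavoidable-bound {H = H} (fromℕ< 0<n) un 0<e e≤N))
  where
  0<n : 0 < n
  0<n = ≤-trans z<s 6≤n
  n³≤e : n ^ 3 ≤ e
  n³≤e = subst (_≤ e) (*-identityˡ (n ^ 3)) 1*n³≤e
  1024e≤n⁴ : 1024 * e ≤ n ^ 4
  1024e≤n⁴ = ≤-trans (*-monoˡ-≤ e (s≤s 1023≤k)) (range-bound (suc k) {n} {e} 0<n e≤)
  0<e : 0 < e
  0<e = ≤-trans (m^n>0 n {{>-nonZero 0<n}} 3) n³≤e
  e¹³n¹²≤N¹³ : e ^ 13 * n ^ 12 ≤ (n C 4) ^ 13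
  e¹³n¹²≤N¹³ = range-sparse (suc k) {n} {e} (≤-trans (m≤m+n 256 768) (s≤s 1023≤k)) (≤-trans (m≤m+n 4 2) 6≤n) e≤
  e≤N : e ≤ n C 4
  e≤N = ^-cancelˡ-≤ 13 {e} {n C 4} (≤-trans (m≤m*n (e ^ 13) (n ^ 12) {{m^n≢0 n 12 {{>-nonZero 0<n}}}}) e¹³n¹²≤N¹³)

-- The clique gives v ≤ 8 e^(1/4), which explains the constant 8 in `LogBound`.
dense-case : ∀ c n e → 1 ≤ c → 1 ≤ n → c ^ 13 * n ^ 40 ≤ e ^ 13 → e ≤ n C 4 →
  ∀ m (H : Graph4 m) → Unavoidable n e H → LogBound 8 n e (numEdges H)
dense-case c n e 0<c 0<n c¹³n⁴⁰≤ e≤N m H un =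
  let t , t≤n , e≤tC4 , t⁴≤ = clique-size 0<e e≤N
  in λ a b _ → log-bound {u = numEdges H} {length (support H)} {8} 0<n 0<e z<s
       (unavoidable-bound {H = H} (fromℕ< 0<n) un 0<e e≤N)
       (≤-trans (^-monoˡ-≤ 4 (clique-support {H = H} t un t≤n e≤tC4)) t⁴≤) a b
  where
  0<e : 0 < e
  0<e = n≢0⇒n>0 λ { refl → <⇒≱ (*-mono-< (m^n>0 c {{>-nonZero 0<c}} 13) (m^n>0 n {{>-nonZero 0<n}} 40)) c¹³n⁴⁰≤ }

theorem5p10 : (∃ λ C0 → ∃ λ k → ∃ λ D → ∃ λ n0 →
    ∀ n e → n0 ≤ n → C0 * n ^ 3 ≤ e → suc k ^ 13 * e ^ 13 ≤ n ^ 40 →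
    ∀ m (H : Graph4 m) → Unavoidable n e H →
    numEdges H ^ 3 * n ^ 10 ≤ D ^ 3 * e ^ 4)
    ×
    (∃ λ C1 → ∃ λ D → ∃ λ n0 →
    ∀ n e → n0 ≤ n → C1 ^ 13 * n ^ 40 ≤ e ^ 13 → e ≤ n C 4 →
    ∀ m (H : Graph4 m) → Unavoidable n e H →
    LogBound D n e (numEdges H))
-- In (i), D is the product of 2 from u ≤ 2v, 432 from the star and 16, the cube root of 4096, from
-- the blocks.
theorem5p10 = (1 , 1023 , 2 * 432 * 16 , 6 , λ n e → sparse-case 1023 n e ≤-refl) , (1 , 8 , 1 , λ n e → dense-case 1 n e ≤-refl)
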